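{- Let $G$ be a connected bipartite graph. (i) If $\delta(G)<\Delta(G)\le 3$, then $\operatorname{reg}(G)\le 2\operatorname{im}(G)$. (ii) If $G$ is $3$-regular, then $\operatorname{reg}(G)\le 2\operatorname{im}(G)+1$.
   Context: $\delta(G),\Delta(G)$ are the minimum and maximum degree. $\operatorname{reg}(G)=\max\{j\ge0:\widetilde H_{j-1}(\operatorname{Ind}(G[S]);\Bbbk)\neq0\text{ for some }S\subseteq V(G)\}$ over a field $\Bbbk$ ($\operatorname{Ind}$ = independence complex). $\operatorname{im}(G)$ is the induced matching number. -}

module Defs where

open import Level using (Level; 0ℓ; _⊔_)
open import Algebra.Apartness.Bundles using (HeytingField)
open import Algebra.Bundles using (CommutativeRing; Semiring)
import Algebra.Definitions.RawSemiring as RawSemiringDefs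
import Algebra.Properties.CommutativeMonoid.Sum as SumProperties
open import Data.Bool.Base using (Bool; if_then_else_)
open import Data.Empty using (⊥-elim)
open import Data.Fin.Base using (Fin)
import Data.Fin.Properties as Fin
open import Data.Fin.Subset using (Subset; _∈_; _⊆_; _∪_; ⁅_⁆; ∣_∣; ⊥; _∩_)
open import Data.Fin.Subset.Properties using
  (_∈?_; ⊆-trans; ⊥⊆; ∉⊥; ∣⊥∣≡0; ∣p∣≤n; p⊆q⇒∣p∣≤∣q∣; x∈p⇒∣p-x∣<∣p∣; x∈⁅x⁆; q⊆p∪q)
open import Data.List.Base using (List; map; allFin)
import Data.List.Extrema.Nat as Extrema
open import Data.Nat.Base using (ℕ; zero; suc; _≤_; _<_; _≡ᵇ_)
import Data.Nat.Properties as ℕ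
open import Data.Product.Base using (Σ-syntax; ∃; _×_; _,_; proj₁; proj₂)
open import Data.Sum.Base using (_⊎_; inj₁)
open import Data.Vec.Base using (tabulate)
open import Relation.Binary.Construct.Closure.ReflexiveTransitive using (Star)
open import Relation.Binary.Core using (Rel)
open import Relation.Binary.Definitions using (Decidable; Symmetric; Irreflexive)
open import Relation.Binary.PropositionalEquality as ≡ using (_≡_; _≢_; cong; subst)
open import Relation.Nullary using (¬_; does; yes; no; contradiction)

private
  variable
    a c ℓ₁ ℓ₂ : Level
    n : ℕ

IsMaximum : (ℕ → Set a) → ℕ → Set a
IsMaximum P m = P m × (∀ j → P j → j ≤ m)

------------------------------------------------------------------------
-- Finite simple graphs

record SimpleGraph (n : ℕ) : Set₁ where
  field
    Adj    : Rel (Fin n) 0ℓ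
    adj?   : Decidable Adj
    sym    : Symmetric Adj
    irrefl : Irreflexive _≡_ Adj

module _ (G : SimpleGraph n) where
  open SimpleGraph G

  Connected : Set
  Connected = Fin n × (∀ u v → Star Adj u v)

  Bipartite : Set
  Bipartite = Σ[ colour ∈ (Fin n → Bool) ] (∀ {u v} → Adj u v → colour u ≢ colour v)

  neighbours : Fin n → Subset n
  neighbours v = tabulate (λ u → does (adj? v u))

  degree : Fin n → ℕ
  degree v = ∣ neighbours v ∣

  degrees : List ℕ
  degrees = map degree (allFin n)

  -- The first arguments of max and min are their values on the empty list.
  -- Every degree lies between 0 and n, so they have no effect on a
  -- nonempty graph.

  Δ : ℕ
  Δ = Extrema.max 0 degrees

  δ : ℕ
  δ = Extrema.min n degrees

  Regular : ℕ → Set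
  Regular d = ∀ v → degree v ≡ d

  -- m edges such that distinct ones share no endpoint and are joined by
  -- no edge of G.

  record InducedMatching (m : ℕ) : Set where
    field
      source target : Fin m → Fin n
      isEdge        : ∀ i → Adj (source i) (target i)

    EndOf : Fin m → Fin n → Set
    EndOf i v = v ≡ source i ⊎ v ≡ target i

    field
      separated : ∀ {i j} → i ≢ j → ∀ {u v} → EndOf i u → EndOf j v →
                  u ≢ v × ¬ Adj u v

  IsInducedMatchingNumber : ℕ → Set
  IsInducedMatchingNumber = IsMaximum InducedMatching

  Independent : Subset n → Set
  Independent σ = ∀ {u v} → u ∈ σ → v ∈ σ → ¬ Adj u v

------------------------------------------------------------------------
-- Simplicial complexes and their reduced homology

record SimplicialComplex (n : ℕ) : Set₁ where
  field
    Face       : Subset n → Set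
    emptyFace  : Face ⊥
    downClosed : ∀ {σ τ} → σ ⊆ τ → Face τ → Face σ

-- Ind(G[S]): the independent sets of the induced subgraph G[S] are the
-- independent sets of G contained in S.

Ind : SimpleGraph n → Subset n → SimplicialComplex n
Ind G S = record
  { Face       = λ σ → σ ⊆ S × Independent G σ
  ; emptyFace  = ⊥⊆ , λ u∈⊥ → contradiction u∈⊥ ∉⊥
  ; downClosed = λ σ⊆τ (τ⊆S , ind) →
      ⊆-trans σ⊆τ τ⊆S , λ u∈σ v∈σ → ind (σ⊆τ u∈σ) (σ⊆τ v∈σ)
  }

-- In a Heyting field x # y holds iff x - y is invertible, and # is a tight
-- apartness relation; classically this is a field with # being ≉.

module Homology (𝕜 : HeytingField c ℓ₁ ℓ₂) where
  open HeytingField 𝕜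

  private
    R : CommutativeRing c ℓ₁
    R = record { isCommutativeRing = isCommutativeRing }

  open RawSemiringDefs (Semiring.rawSemiring (CommutativeRing.semiring R)) public using (sum; _^_)

  predecessors : Fin n → Subset n
  predecessors v = tabulate (λ u → does (u Fin.<? v))

  -- The position of v in τ ∪ {v}, with vertices in increasing order, is
  -- the number of elements of τ below v.

  sign : Fin n → Subset n → Carrier
  sign v τ = (- 1#) ^ ∣ τ ∩ predecessors v ∣

  -- The coefficient at τ of ∂ z, where
  --   ∂ [v₀ < … < vᵢ] = Σₖ (-1)ᵏ [v₀, …, v̂ₖ, …, vᵢ].
  -- This includes the augmentation, whose value is the coefficient at ∅.

  ∂ : (Subset n → Carrier) → Subset n → Carrier
  ∂ z τ = sum λ v → if does (v ∈? τ) then 0# else sign v τ * z (τ ∪ ⁅ v ⁆)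

  module _ (K : SimplicialComplex n) where
    open SimplicialComplex K

    -- The augmented chain group in dimension j - 1: chains on the faces
    -- with j vertices, extended by zero to all vertex sets.

    record Chain (j : ℕ) : Set (c ⊔ ℓ₁) where
      field
        coeff   : Subset n → Carrier
        support : ∀ σ → ¬ (Face σ × ∣ σ ∣ ≡ j) → coeff σ ≈ 0#

    open Chain public

    IsCycle : ∀ {j} → Chain j → Set ℓ₁
    IsCycle z = ∀ τ → ∂ (coeff z) τ ≈ 0#

    IsBoundary : ∀ {j} → Chain j → Set (c ⊔ ℓ₁)
    IsBoundary {j} z = Σ[ w ∈ Chain (suc j) ] (∀ σ → ∂ (coeff w) σ ≈ coeff z σ)

    -- H̃_{j-1}(K; 𝕜) ≠ 0: some cycle represents a nonzero class.

    HomologyNonzero : ℕ → Set (c ⊔ ℓ₁)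
    HomologyNonzero j = Σ[ z ∈ Chain j ] IsCycle z × ¬ IsBoundary z

  IsRegularity : SimpleGraph n → ℕ → Set (c ⊔ ℓ₁)
  IsRegularity {n = n} G =
    IsMaximum (λ j → Σ[ S ∈ Subset n ] HomologyNonzero (Ind G S) j)

  private
    sum-zero : (f : Fin n → Carrier) → (∀ v → f v ≈ 0#) → sum f ≈ 0#
    sum-zero {n = n} f f≈0 =
      CommutativeRing.trans R (S.sum-cong-≋ f≈0) (S.sum-replicate-zero n)
      where module S = SumProperties (CommutativeRing.+-commutativeMonoid R)

    ∂-zero : (z : Subset n → Carrier) → ∀ τ → (∀ v → z (τ ∪ ⁅ v ⁆) ≈ 0#) →
             ∂ z τ ≈ 0#
    ∂-zero z τ z≈0 = sum-zero _ term
      where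
      module R = CommutativeRing R
      term : ∀ v → (if does (v ∈? τ) then 0# else sign v τ * z (τ ∪ ⁅ v ⁆)) ≈ 0#
      term v with v ∈? τ
      ... | yes _ = R.refl
      ... | no  _ = R.trans (R.*-congˡ (z≈0 v)) (R.zeroʳ _)

    1≉0 : ¬ (1# ≈ 0#)
    1≉0 1≈0 = #-irrefl R.refl (invertible⇒# {0#} {0#} (0# , all≈ , all≈))
      where
      module R = CommutativeRing R
      all≈ : ∀ {x} → x ≈ 1#
      all≈ {x} = R.trans (≈0 x) (R.sym 1≈0)
        where
        ≈0 : ∀ y → y ≈ 0#
        ≈0 y = R.trans (R.sym (R.*-identityʳ y)) (R.trans (R.*-congˡ 1≈0) (R.zeroʳ y))

  homologyNonzero-bounded : (K : SimplicialComplex n) → ∀ j →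
                            HomologyNonzero K j → j ≤ n
  homologyNonzero-bounded {n = n} K j (z , _ , z∉B) with j ℕ.≤? n
  ... | yes j≤n = j≤n
  ... | no  j≰n = contradiction (zeroChain , bounds) z∉B
    where
    module R = CommutativeRing R
    zeroChain : Chain K (suc j)
    zeroChain = record { coeff = λ _ → 0# ; support = λ _ _ → R.refl }
    bounds : ∀ σ → ∂ (λ _ → 0#) σ ≈ coeff z σ
    bounds σ = R.trans (∂-zero _ σ (λ _ → R.refl))
      (R.sym (support z σ λ (_ , ∣σ∣≡j) → j≰n (subst (_≤ n) ∣σ∣≡j (∣p∣≤n σ))))

  -- H̃₋₁(Ind(∅)) = 𝕜.

  homologyNonzero-∅ : (G : SimpleGraph n) → HomologyNonzero (Ind G ⊥) 0
  homologyNonzero-∅ {n = n} G = z , cycle , not-boundary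
    where
    module R = CommutativeRing R
    K = Ind G ⊥

    ∣σ∣≡0 : ∀ {σ} → SimplicialComplex.Face K σ → ∣ σ ∣ ≡ 0
    ∣σ∣≡0 {σ} (σ⊆⊥ , _) =
      ℕ.n≤0⇒n≡0 (subst (∣ σ ∣ ≤_) (∣⊥∣≡0 n) (p⊆q⇒∣p∣≤∣q∣ σ⊆⊥))

    empties : Subset n → Carrier
    empties σ = if ∣ σ ∣ ≡ᵇ 0 then 1# else 0#

    ⊆⊥ : ∀ σ → ∣ σ ∣ ≡ 0 → σ ⊆ ⊥
    ⊆⊥ σ ∣σ∣≡0 x∈σ = contradiction
      (ℕ.<-≤-trans (x∈p⇒∣p-x∣<∣p∣ x∈σ) (ℕ.≤-reflexive ∣σ∣≡0)) ℕ.n≮0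

    supp : ∀ σ → ¬ (SimplicialComplex.Face K σ × ∣ σ ∣ ≡ 0) → empties σ ≈ 0#
    supp σ ¬face with ∣ σ ∣ in eq
    ... | suc _ = R.refl
    ... | zero  = ⊥-elim
      (¬face ((⊆⊥ σ eq , λ u∈σ → contradiction (⊆⊥ σ eq u∈σ) ∉⊥) , ≡.refl))

    z : Chain K 0
    z = record { coeff = empties ; support = supp }

    cycle : IsCycle K z
    cycle τ = ∂-zero empties τ λ v → supp _ λ ((τv⊆⊥ , _) , _) →
      contradiction (τv⊆⊥ (q⊆p∪q τ ⁅ v ⁆ (x∈⁅x⁆ v))) ∉⊥

    empties-⊥ : empties ⊥ ≡ 1#
    empties-⊥ = cong (λ k → if k ≡ᵇ 0 then 1# else 0#) (∣⊥∣≡0 n)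

    not-boundary : ¬ IsBoundary K z
    not-boundary (w , ∂w≈z) = 1≉0 (R.trans (R.sym (R.reflexive empties-⊥))
      (R.trans (R.sym (∂w≈z ⊥)) (∂-zero (coeff w) ⊥ λ v → support w _
        λ (face , ∣σ∣≡1) → contradiction (≡.trans (≡.sym (∣σ∣≡0 face)) ∣σ∣≡1) λ ())))

open Homology public using (IsRegularity)

------------------------------------------------------------------------
-- Both maxima exist; doubly negated because homology over an arbitrary
-- Heyting field need not be decidable.

maximum-exists : (P : ℕ → Set a) → P 0 → ∀ b → (∀ j → P j → j ≤ b) →
                 ¬ ¬ ∃ (IsMaximum P)
maximum-exists P P0 zero    bound k = k (0 , P0 , bound)
maximum-exists P P0 (suc b) bound k = ¬Pb (λ Pb → k (suc b , Pb , bound))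
  where
  ¬Pb : ¬ ¬ P (suc b)
  ¬Pb ¬p = maximum-exists P P0 b (λ j Pj → ℕ.≤-pred (ℕ.≤∧≢⇒< (bound j Pj)
             λ { ≡.refl → ¬p Pj })) k

regularity-exists : (𝕜 : HeytingField c ℓ₁ ℓ₂) (G : SimpleGraph n) →
                    ¬ ¬ ∃ (IsRegularity 𝕜 G)
regularity-exists {n = n} 𝕜 G = maximum-exists _
  (⊥ , Homology.homologyNonzero-∅ 𝕜 G) n
  λ j (S , nz) → Homology.homologyNonzero-bounded 𝕜 (Ind G S) j nz

inducedMatchingNumber-exists : (G : SimpleGraph n) →
                               ¬ ¬ ∃ (IsInducedMatchingNumber G)
inducedMatchingNumber-exists {n = n} G = maximum-exists _ empty n bound
  where
  empty : InducedMatching G 0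
  empty = record { source = λ () ; target = λ () ; isEdge = λ () ; separated = λ { {()} } }

  bound : ∀ j → InducedMatching G j → j ≤ n
  bound j M = Fin.injective⇒≤ injective
    where
    open InducedMatching M
    injective : ∀ {i k} → source i ≡ source k → i ≡ k
    injective {i} {k} eq with i Fin.≟ k
    ... | yes i≡k = i≡k
    ... | no  i≢k = contradiction eq (proj₁ (separated i≢k (inj₁ ≡.refl) (inj₁ ≡.refl)))

{-# OPTIONS --safe #-}

-- The bound reg ≤ d · im holds for every graph all of whose nonempty induced
-- subgraphs have a vertex of degree at most d.  Let u be such a vertex of G[S].
-- For a vertex v, nonzero homology of Ind(G[S]) in degree j gives nonzero
-- homology of Ind(G[S - v]) in degree j or of Ind(G[S - N[v]]) in degree j - 1.
-- Apply this to the neighbours of u in turn.  If all are deleted, u becomes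
-- isolated and the complex is a cone, which is acyclic.  Otherwise some v was
-- removed with its closed neighbourhood, the degree dropped by at most d, and
-- the remaining vertices avoid N[u] ∪ N[v], so the edge uv extends any induced
-- matching among them.
--
-- A connected graph with Δ ≤ 3 and a vertex of degree at most 2 is covered with
-- d = 2, as is every proper induced subgraph of a connected cubic graph; the
-- cubic graph itself costs one more splitting step.

module Submission where

open import Defs
open import Level using (Level)
open import Algebra.Apartness.Bundles using (HeytingField; HeytingCommutativeRing)
open import Algebra.Bundles using (CommutativeRing)
import Algebra.Properties.AbelianGroup as AbelianGroupProperties
import Algebra.Properties.CommutativeSemigroup as CommutativeSemigroupProperties
import Algebra.Properties.Ring as RingProperties
import Algebra.Properties.Semiring.Sum as SumProperties
open import Data.Bool.Base using (if_then_else_)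
open import Data.Fin.Base using (Fin; zero; suc; punchIn) renaming (_<_ to _<ᶠ_)
import Data.Fin.Properties as Fin
open import Data.Fin.Subset using
  (Subset; inside; outside; Nonempty; Empty; _∈_; _∉_; _⊆_; _⊂_; _∪_; _∩_; _─_; _-_; ⁅_⁆; ∣_∣)
open import Data.Fin.Subset.Induction using (⊂-wellFounded)
open import Data.Fin.Subset.Properties using
  ( _∈?_; nonempty?; Empty-unique; ∣⊥∣≡0; ∣p∣≤n; p⊂q⇒∣p∣<∣q∣; x∈p⇒∣p-x∣<∣p∣
  ; ⊆-antisym; ⊆-refl; x∈⁅x⁆; x∈⁅y⁆⇒x≡y; p⊆p∪q; q⊆p∪q; x∈p∪q⁻
  ; x∈p∩q⁺; x∈p∩q⁻; ∣p∩q∣≤∣p∣; p─q⊆p; x∈p∧x∉q⇒x∈p─q; x∈p∧x≢y⇒x∈p-y; ∪-identityʳ)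
open import Data.List.Base using (allFin)
import Data.Nat.Properties as ℕ
import Data.List.Extrema ℕ.≤-totalOrder as Extrema
open import Data.List.Membership.Propositional.Properties using (∈-map⁺; ∈-allFin)
import Data.List.Relation.Unary.All as All
import Data.List.Relation.Unary.All.Properties as All
open import Data.Nat.Base using (ℕ; zero; suc; _+_; _*_; _≤_; _<_; z≤n; s≤s)
open import Data.Product.Base using (Σ-syntax; ∃; ∃₂; ∃-syntax; _×_; _,_; proj₁; proj₂)
open import Data.Sum.Base using (_⊎_; inj₁; inj₂; [_,_]′)
open import Data.Vec.Base using (_∷_; tabulate; here; there)
open import Data.Vec.Properties using (lookup∘tabulate; []=⇒lookup; lookup⇒[]=)
open import Function.Base using (_∘_)
open import Induction.WellFounded using (Acc; acc)
open import Relation.Binary.Construct.Closure.ReflexiveTransitive using (Star; ε; _◅_)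
open import Relation.Binary.Definitions using (tri<; tri≈; tri>)
open import Relation.Binary.PropositionalEquality as ≡ using (_≡_; _≢_; cong; subst)
open import Relation.Nullary using (¬_; Dec; does; yes; no; contradiction)
open import Relation.Nullary.Decidable using (dec-true; dec-false; decidable-stable; _×-dec_)

private
  variable
    a c ℓ₁ ℓ₂ : Level
    n : ℕ

-- Subsets

∈-tabulate⁺ : {P : Fin n → Set a} (P? : ∀ u → Dec (P u)) {u : Fin n} →
              P u → u ∈ tabulate (does ∘ P?)
∈-tabulate⁺ P? {u} Pu =
  lookup⇒[]= u _ (≡.trans (lookup∘tabulate (does ∘ P?) u) (dec-true (P? u) Pu))

∈-tabulate⁻ : {P : Fin n → Set a} (P? : ∀ u → Dec (P u)) {u : Fin n} →
              u ∈ tabulate (does ∘ P?) → P u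
∈-tabulate⁻ P? {u} u∈
  with P? u | ≡.trans (≡.sym (lookup∘tabulate (does ∘ P?) u)) ([]=⇒lookup u∈)
... | yes Pu | _ = Pu

x∈p─q⇒x∉q : ∀ {x : Fin n} p q → x ∈ p ─ q → x ∉ q
x∈p─q⇒x∉q (_ ∷ p) (_ ∷ q) () here
x∈p─q⇒x∉q (_ ∷ p) (_ ∷ q) (there x∈p─q) (there x∈q) = x∈p─q⇒x∉q p q x∈p─q x∈q

module _ {p : Subset n} where

  x∈p-y⇒x∈p : ∀ {x y} → x ∈ p - y → x ∈ p
  x∈p-y⇒x∈p = p─q⊆p p ⁅ _ ⁆

  x∉p-x : ∀ {x} → x ∉ p - x
  x∉p-x {x} x∈p-x = x∈p─q⇒x∉q p ⁅ x ⁆ x∈p-x (x∈⁅x⁆ x)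

  x∈p-y⇒x≢y : ∀ {x y} → x ∈ p - y → x ≢ y
  x∈p-y⇒x≢y x∈p-y ≡.refl = x∉p-x x∈p-y

  x∈p∪⁅x⁆ : ∀ {x} → x ∈ p ∪ ⁅ x ⁆
  x∈p∪⁅x⁆ {x} = q⊆p∪q p ⁅ x ⁆ (x∈⁅x⁆ x)

  x∈p∪⁅y⁆⁻ : ∀ {x y} → x ∈ p ∪ ⁅ y ⁆ → x ∈ p ⊎ x ≡ y
  x∈p∪⁅y⁆⁻ {y = y} x∈ with x∈p∪q⁻ p ⁅ y ⁆ x∈
  ... | inj₁ x∈p = inj₁ x∈p
  ... | inj₂ x∈y = inj₂ (x∈⁅y⁆⇒x≡y y x∈y)

  p-x∪⁅x⁆≡p : ∀ {x} → x ∈ p → (p - x) ∪ ⁅ x ⁆ ≡ p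
  p-x∪⁅x⁆≡p {x} x∈p = ⊆-antisym to from
    where
    to : (p - x) ∪ ⁅ x ⁆ ⊆ p
    to y∈ with x∈p∪q⁻ (p - x) ⁅ x ⁆ y∈
    ... | inj₁ y∈p-x = x∈p-y⇒x∈p y∈p-x
    ... | inj₂ y∈⁅x⁆ = subst (_∈ p) (≡.sym (x∈⁅y⁆⇒x≡y x y∈⁅x⁆)) x∈p
    from : p ⊆ (p - x) ∪ ⁅ x ⁆
    from {y} y∈p with y Fin.≟ x
    ... | yes ≡.refl = q⊆p∪q (p - x) ⁅ x ⁆ (x∈⁅x⁆ x)
    ... | no  y≢x    = p⊆p∪q ⁅ x ⁆ (x∈p∧x≢y⇒x∈p-y y∈p y≢x)

  p∪⁅x⁆-x≡p : ∀ {x} → x ∉ p → (p ∪ ⁅ x ⁆) - x ≡ p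
  p∪⁅x⁆-x≡p {x} x∉p = ⊆-antisym to from
    where
    to : (p ∪ ⁅ x ⁆) - x ⊆ p
    to y∈ with x∈p∪⁅y⁆⁻ (p─q⊆p (p ∪ ⁅ x ⁆) ⁅ x ⁆ y∈)
    ... | inj₁ y∈p = y∈p
    ... | inj₂ ≡.refl = contradiction (x∈⁅x⁆ x) (x∈p─q⇒x∉q (p ∪ ⁅ x ⁆) ⁅ x ⁆ y∈)
    from : p ⊆ (p ∪ ⁅ x ⁆) - x
    from y∈p = x∈p∧x≢y⇒x∈p-y (p⊆p∪q ⁅ x ⁆ y∈p) λ { ≡.refl → x∉p y∈p }

p∪⁅x⁆-y≡p-y∪⁅x⁆ : ∀ (p : Subset n) {x y} → x ≢ y → (p ∪ ⁅ x ⁆) - y ≡ (p - y) ∪ ⁅ x ⁆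
p∪⁅x⁆-y≡p-y∪⁅x⁆ p {x} {y} x≢y = ⊆-antisym to from
  where
  to : (p ∪ ⁅ x ⁆) - y ⊆ (p - y) ∪ ⁅ x ⁆
  to w∈ with x∈p∪⁅y⁆⁻ (x∈p-y⇒x∈p {p = p ∪ ⁅ x ⁆} w∈)
  ... | inj₁ w∈p    = p⊆p∪q ⁅ x ⁆ (x∈p∧x≢y⇒x∈p-y w∈p (x∈p-y⇒x≢y {p = p ∪ ⁅ x ⁆} w∈))
  ... | inj₂ ≡.refl = x∈p∪⁅x⁆
  from : (p - y) ∪ ⁅ x ⁆ ⊆ (p ∪ ⁅ x ⁆) - y
  from w∈ with x∈p∪⁅y⁆⁻ {p = p - y} w∈
  ... | inj₁ w∈p-y  = x∈p∧x≢y⇒x∈p-y (p⊆p∪q ⁅ x ⁆ (x∈p-y⇒x∈p w∈p-y)) (x∈p-y⇒x≢y {p = p} w∈p-y)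
  ... | inj₂ ≡.refl = x∈p∧x≢y⇒x∈p-y x∈p∪⁅x⁆ x≢y

∣p∪⁅x⁆∣≡1+∣p∣ : ∀ (p : Subset n) {x} → x ∉ p → ∣ p ∪ ⁅ x ⁆ ∣ ≡ suc ∣ p ∣
∣p∪⁅x⁆∣≡1+∣p∣ (inside  ∷ p) {zero}  x∉p = contradiction here x∉p
∣p∪⁅x⁆∣≡1+∣p∣ (outside ∷ p) {zero}  x∉p = cong (suc ∘ ∣_∣) (∪-identityʳ p)
∣p∪⁅x⁆∣≡1+∣p∣ (inside  ∷ p) {suc x} x∉p = cong suc (∣p∪⁅x⁆∣≡1+∣p∣ p (x∉p ∘ there))
∣p∪⁅x⁆∣≡1+∣p∣ (outside ∷ p) {suc x} x∉p = ∣p∪⁅x⁆∣≡1+∣p∣ p (x∉p ∘ there)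

-- With `q` the predecessors of a vertex, this and the next lemma compare the exponents of its sign
-- before and after `x` is added.
[p∪⁅x⁆]∩q≡p∩q : ∀ (p q : Subset n) {x} → x ∉ q → (p ∪ ⁅ x ⁆) ∩ q ≡ p ∩ q
[p∪⁅x⁆]∩q≡p∩q p q {x} x∉q = ⊆-antisym to from
  where
  to : (p ∪ ⁅ x ⁆) ∩ q ⊆ p ∩ q
  to y∈ with x∈p∩q⁻ (p ∪ ⁅ x ⁆) q y∈
  ... | y∈p∪x , y∈q with x∈p∪⁅y⁆⁻ y∈p∪x
  ...   | inj₁ y∈p    = x∈p∩q⁺ (y∈p , y∈q)
  ...   | inj₂ ≡.refl = contradiction y∈q x∉q
  from : p ∩ q ⊆ (p ∪ ⁅ x ⁆) ∩ q
  from y∈ with x∈p∩q⁻ p q y∈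
  ... | y∈p , y∈q = x∈p∩q⁺ (p⊆p∪q ⁅ x ⁆ y∈p , y∈q)

[p∪⁅x⁆]∩q≡p∩q∪⁅x⁆ : ∀ (p q : Subset n) {x} → x ∈ q → (p ∪ ⁅ x ⁆) ∩ q ≡ (p ∩ q) ∪ ⁅ x ⁆
[p∪⁅x⁆]∩q≡p∩q∪⁅x⁆ p q {x} x∈q = ⊆-antisym to from
  where
  to : (p ∪ ⁅ x ⁆) ∩ q ⊆ (p ∩ q) ∪ ⁅ x ⁆
  to y∈ with x∈p∩q⁻ (p ∪ ⁅ x ⁆) q y∈
  ... | y∈p∪x , y∈q with x∈p∪⁅y⁆⁻ y∈p∪x
  ...   | inj₁ y∈p    = p⊆p∪q ⁅ x ⁆ (x∈p∩q⁺ (y∈p , y∈q))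
  ...   | inj₂ ≡.refl = x∈p∪⁅x⁆
  from : (p ∩ q) ∪ ⁅ x ⁆ ⊆ (p ∪ ⁅ x ⁆) ∩ q
  from y∈ with x∈p∪⁅y⁆⁻ {p = p ∩ q} y∈
  ... | inj₂ ≡.refl = x∈p∩q⁺ (x∈p∪⁅x⁆ , x∈q)
  ... | inj₁ y∈p∩q with x∈p∩q⁻ p q y∈p∩q
  ...   | y∈p , y∈q = x∈p∩q⁺ (p⊆p∪q ⁅ x ⁆ y∈p , y∈q)

if-yes : ∀ {P : Set a} {A : Set c} (P? : Dec P) {x y : A} → P →
         (if does P? then x else y) ≡ x
if-yes P? p rewrite dec-true P? p = ≡.refl

if-no : ∀ {P : Set a} {A : Set c} (P? : Dec P) {x y : A} → ¬ P →
        (if does P? then x else y) ≡ y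
if-no P? ¬p rewrite dec-false P? ¬p = ≡.refl

-- Chains on the full simplex

module SimplexChains (𝕜 : HeytingField c ℓ₁ ℓ₂) where

  open CommutativeRing
    (HeytingCommutativeRing.commutativeRing (HeytingField.heytingCommutativeRing 𝕜))
    hiding (zero) renaming (_+_ to _⊹_; _*_ to _⊛_; -_ to ⊝_; _-_ to _⊟_) public
  open import Relation.Binary.Reasoning.Setoid setoid public
  open Homology 𝕜 public
  open AbelianGroupProperties +-abelianGroup public using (xyx⁻¹≈y; inverseˡ-unique; ⁻¹-involutive)
  open RingProperties ring public using (-1*x≈-x; -‿distribˡ-*; -‿distribʳ-*)
  open CommutativeSemigroupProperties +-commutativeSemigroup public using (x∙yz≈y∙xz)
  private module S = SumProperties semiring

  sum-single : (f : Fin n → Carrier) (u : Fin n) → (∀ v → v ≢ u → f v ≈ 0#) → sum f ≈ f u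
  sum-single {n = suc n} f u f≈0 = begin
    sum f                        ≈⟨ S.sum-remove {i = u} f ⟩
    f u ⊹ sum (f ∘ punchIn u)    ≈⟨ +-congˡ (S.sum-cong-≋ λ v → f≈0 _ (Fin.punchInᵢ≢i u v)) ⟩
    f u ⊹ sum {n} (λ _ → 0#)     ≈⟨ +-congˡ (S.sum-replicate-zero n) ⟩
    f u ⊹ 0#                     ≈⟨ +-identityʳ _ ⟩
    f u                          ∎

  -- ∂ z τ is, definitionally, the sum of link v z τ over all v.

  link cone deletion : Fin n → (Subset n → Carrier) → Subset n → Carrier
  link     u z τ = if does (u ∈? τ) then 0# else sign u τ ⊛ z (τ ∪ ⁅ u ⁆)
  cone     u z σ = if does (u ∈? σ) then sign u (σ - u) ⊛ z (σ - u) else 0#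
  deletion u z σ = if does (u ∈? σ) then 0# else z σ

  module _ (z : Subset n → Carrier) {u : Fin n} {τ : Subset n} where

    link-∉ : u ∉ τ → link u z τ ≈ sign u τ ⊛ z (τ ∪ ⁅ u ⁆)
    link-∉ u∉τ = reflexive (if-no (u ∈? τ) u∉τ)

    link-∈ : u ∈ τ → link u z τ ≈ 0#
    link-∈ u∈τ = reflexive (if-yes (u ∈? τ) u∈τ)

    cone-∉ : u ∉ τ → cone u z τ ≈ 0#
    cone-∉ u∉τ = reflexive (if-no (u ∈? τ) u∉τ)

    cone-∈ : u ∈ τ → cone u z τ ≈ sign u (τ - u) ⊛ z (τ - u)
    cone-∈ u∈τ = reflexive (if-yes (u ∈? τ) u∈τ)

    deletion-∉ : u ∉ τ → deletion u z τ ≈ z τ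
    deletion-∉ u∉τ = reflexive (if-no (u ∈? τ) u∉τ)

    deletion-∈ : u ∈ τ → deletion u z τ ≈ 0#
    deletion-∈ u∈τ = reflexive (if-yes (u ∈? τ) u∈τ)

  link-cong : ∀ (u : Fin n) {y z : Subset n → Carrier} {τ} →
              y (τ ∪ ⁅ u ⁆) ≈ z (τ ∪ ⁅ u ⁆) → link u y τ ≈ link u z τ
  link-cong u {τ = τ} y≈z with u ∈? τ
  ... | yes _ = refl
  ... | no  _ = *-congˡ y≈z

  cone-cong : ∀ (u : Fin n) {y z : Subset n → Carrier} → (∀ σ → y σ ≈ z σ) →
              ∀ σ → cone u y σ ≈ cone u z σ
  cone-cong u y≈z σ with u ∈? σ
  ... | yes _ = *-congˡ (y≈z _)
  ... | no  _ = refl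

  cone-0 : ∀ (u : Fin n) {z : Subset n → Carrier} → (∀ σ → z σ ≈ 0#) → ∀ σ → cone u z σ ≈ 0#
  cone-0 u z≈0 σ with u ∈? σ
  ... | yes _ = trans (*-congˡ (z≈0 _)) (zeroʳ _)
  ... | no  _ = refl

  link-+ : ∀ (u : Fin n) (y z : Subset n → Carrier) τ →
           link u (λ σ → y σ ⊹ z σ) τ ≈ link u y τ ⊹ link u z τ
  link-+ u y z τ with u ∈? τ
  ... | yes _ = sym (+-identityˡ 0#)
  ... | no  _ = distribˡ _ _ _

  module _ {n : ℕ} where

    ∂-cong : {y z : Subset n → Carrier} → (∀ σ → y σ ≈ z σ) → ∀ τ → ∂ y τ ≈ ∂ z τ
    ∂-cong {y} {z} y≈z τ = S.sum-cong-≋ λ v → link-cong v {y} {z} (y≈z _)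

    ∂-+ : (y z : Subset n → Carrier) → ∀ τ → ∂ (λ σ → y σ ⊹ z σ) τ ≈ ∂ y τ ⊹ ∂ z τ
    ∂-+ y z τ = trans (S.sum-cong-≋ λ v → link-+ v y z τ)
                      (S.∑-distrib-+ (λ v → link v y τ) (λ v → link v z τ))

    ∂-0 : (z : Subset n → Carrier) → ∀ τ → (∀ v → z (τ ∪ ⁅ v ⁆) ≈ 0#) → ∂ z τ ≈ 0#
    ∂-0 z τ z≈0 = trans (S.sum-cong-≋ term) (S.sum-replicate-zero n)
      where
      term : ∀ v → link v z τ ≈ 0#
      term v with v ∈? τ
      ... | yes _ = refl
      ... | no  _ = trans (*-congˡ (z≈0 v)) (zeroʳ _)

    ∂-⊝ : (z : Subset n → Carrier) → ∀ τ → ∂ (λ σ → ⊝ z σ) τ ≈ ⊝ ∂ z τ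
    ∂-⊝ z τ = inverseˡ-unique _ _ (begin
      ∂ (λ σ → ⊝ z σ) τ ⊹ ∂ z τ    ≈⟨ ∂-+ (λ σ → ⊝ z σ) z τ ⟨
      ∂ (λ σ → ⊝ z σ ⊹ z σ) τ      ≈⟨ ∂-0 (λ σ → ⊝ z σ ⊹ z σ) τ (λ v → -‿inverseˡ _) ⟩
      0#                           ∎)

  -- Signs

  -1*-1≈1 : ⊝ 1# ⊛ ⊝ 1# ≈ 1#
  -1*-1≈1 = trans (-1*x≈-x (⊝ 1#)) (⁻¹-involutive 1#)

  -1^k*-1^k≈1 : ∀ k → (⊝ 1#) ^ k ⊛ (⊝ 1#) ^ k ≈ 1#
  -1^k*-1^k≈1 zero    = *-identityˡ 1#
  -1^k*-1^k≈1 (suc k) = begin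
    (⊝ 1# ⊛ e) ⊛ (⊝ 1# ⊛ e)   ≈⟨ interchange _ _ _ _ ⟩
    (⊝ 1# ⊛ ⊝ 1#) ⊛ (e ⊛ e)   ≈⟨ *-cong -1*-1≈1 (-1^k*-1^k≈1 k) ⟩
    1# ⊛ 1#                   ≈⟨ *-identityˡ 1# ⟩
    1#                        ∎
    where
    e = (⊝ 1#) ^ k
    open CommutativeSemigroupProperties *-commutativeSemigroup using (interchange)

  sign-cancel : ∀ (u : Fin n) τ x → sign u τ ⊛ (sign u τ ⊛ x) ≈ x
  sign-cancel u τ x = begin
    sign u τ ⊛ (sign u τ ⊛ x)   ≈⟨ *-assoc _ _ _ ⟨
    (sign u τ ⊛ sign u τ) ⊛ x   ≈⟨ *-congʳ (-1^k*-1^k≈1 ∣ τ ∩ predecessors u ∣) ⟩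
    1# ⊛ x                      ≈⟨ *-identityˡ x ⟩
    x                           ∎

  -- The new vertex `u` lies below `v`, so the position of `v` moves up by one and its sign gains
  -- one factor of -1.
  sign-∪-< : ∀ {u v : Fin n} {ρ} → u ∉ ρ → u <ᶠ v →
             sign v (ρ ∪ ⁅ u ⁆) ≈ ⊝ sign v ρ
  sign-∪-< {u = u} {v} {ρ} u∉ρ u<v = trans
    (reflexive (cong ((⊝ 1#) ^_) (≡.trans
      (cong ∣_∣ ([p∪⁅x⁆]∩q≡p∩q∪⁅x⁆ ρ (predecessors v) (∈-tabulate⁺ (Fin._<? v) u<v)))
      (∣p∪⁅x⁆∣≡1+∣p∣ (ρ ∩ predecessors v) (u∉ρ ∘ proj₁ ∘ x∈p∩q⁻ ρ (predecessors v))))))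
    (-1*x≈-x (sign v ρ))

  sign-∪-≮ : ∀ {u v : Fin n} ρ → ¬ (u <ᶠ v) → sign v (ρ ∪ ⁅ u ⁆) ≈ sign v ρ
  sign-∪-≮ {u = u} {v} ρ u≮v = reflexive (cong (((⊝ 1#) ^_) ∘ ∣_∣)
    ([p∪⁅x⁆]∩q≡p∩q ρ (predecessors v) (u≮v ∘ ∈-tabulate⁻ (Fin._<? v))))

  -- Exactly one of `u` and `v` precedes the other, so exactly one of the two signs changes. This is
  -- the sign rule that usually gives ∂∂ = 0.
  sign-swap : ∀ {u v : Fin n} {ρ} → u ≢ v → u ∉ ρ → v ∉ ρ →
              sign v (ρ ∪ ⁅ u ⁆) ⊛ sign u (ρ ∪ ⁅ v ⁆) ≈ ⊝ (sign u ρ ⊛ sign v ρ)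
  sign-swap {u = u} {v} {ρ} u≢v u∉ρ v∉ρ with Fin.<-cmp u v
  ... | tri≈ _ u≡v _ = contradiction u≡v u≢v
  ... | tri< u<v _ v≮u = begin
    sign v (ρ ∪ ⁅ u ⁆) ⊛ sign u (ρ ∪ ⁅ v ⁆)   ≈⟨ *-cong (sign-∪-< u∉ρ u<v) (sign-∪-≮ ρ v≮u) ⟩
    (⊝ sign v ρ) ⊛ sign u ρ                   ≈⟨ -‿distribˡ-* _ _ ⟨
    ⊝ (sign v ρ ⊛ sign u ρ)                   ≈⟨ -‿cong (*-comm _ _) ⟩
    ⊝ (sign u ρ ⊛ sign v ρ)                   ∎
  ... | tri> u≮v _ v<u = begin
    sign v (ρ ∪ ⁅ u ⁆) ⊛ sign u (ρ ∪ ⁅ v ⁆)   ≈⟨ *-cong (sign-∪-≮ ρ u≮v) (sign-∪-< v∉ρ v<u) ⟩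
    sign v ρ ⊛ ⊝ sign u ρ                     ≈⟨ -‿distribʳ-* _ _ ⟨
    ⊝ (sign v ρ ⊛ sign u ρ)                   ≈⟨ -‿cong (*-comm _ _) ⟩
    ⊝ (sign u ρ ⊛ sign v ρ)                   ∎

  -- The cone homotopy and the decomposition of a cycle at a vertex

  link-cone : ∀ {u : Fin n} {τ} z → u ∉ τ → link u (cone u z) τ ≈ z τ
  link-cone {u = u} {τ} z u∉τ = begin
    link u (cone u z) τ                    ≈⟨ link-∉ (cone u z) u∉τ ⟩
    sign u τ ⊛ cone u z (τ ∪ ⁅ u ⁆)        ≈⟨ *-congˡ (cone-∈ z (x∈p∪⁅x⁆ {p = τ})) ⟩
    sign u τ ⊛ (sign u τ' ⊛ z τ')          ≡⟨ cong (λ ρ → sign u τ ⊛ (sign u ρ ⊛ z ρ)) (p∪⁅x⁆-x≡p u∉τ) ⟩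
    sign u τ ⊛ (sign u τ ⊛ z τ)            ≈⟨ sign-cancel u τ (z τ) ⟩
    z τ                                    ∎
    where τ' = (τ ∪ ⁅ u ⁆) - u

  cone-link : ∀ {u : Fin n} {τ} z → u ∈ τ → cone u (link u z) τ ≈ z τ
  cone-link {u = u} {τ} z u∈τ = begin
    cone u (link u z) τ                                    ≈⟨ cone-∈ (link u z) u∈τ ⟩
    sign u (τ - u) ⊛ link u z (τ - u)                      ≈⟨ *-congˡ (link-∉ z (x∉p-x {p = τ})) ⟩
    sign u (τ - u) ⊛ (sign u (τ - u) ⊛ z ((τ - u) ∪ ⁅ u ⁆)) ≈⟨ sign-cancel u (τ - u) _ ⟩
    z ((τ - u) ∪ ⁅ u ⁆)                                    ≡⟨ cong z (p-x∪⁅x⁆≡p u∈τ) ⟩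
    z τ                                                    ∎

  -- The second term is the `v`-summand of `cone u (∂ z) τ`. Both terms read `z` at the same set,
  -- since adding `v` commutes with removing `u`, and `sign-swap` makes their signs opposite.
  link-cone-anticomm : ∀ {u v : Fin n} {τ} z → v ≢ u → u ∈ τ →
                       link v (cone u z) τ ⊹ sign u (τ - u) ⊛ link v z (τ - u) ≈ 0#
  link-cone-anticomm {u = u} {v} {τ} z v≢u u∈τ with v ∈? τ
  ... | yes v∈τ = begin
    0# ⊹ sign u (τ - u) ⊛ link v z (τ - u)   ≈⟨ +-identityˡ _ ⟩
    sign u (τ - u) ⊛ link v z (τ - u)        ≈⟨ *-congˡ (link-∈ z (x∈p∧x≢y⇒x∈p-y v∈τ v≢u)) ⟩
    sign u (τ - u) ⊛ 0#                      ≈⟨ zeroʳ _ ⟩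
    0#                                       ∎
  ... | no v∉τ = begin
    sign v τ ⊛ cone u z (τ ∪ ⁅ v ⁆) ⊹ sign u ρ ⊛ link v z ρ
      ≈⟨ +-cong (*-congˡ (cone-∈ z (p⊆p∪q ⁅ v ⁆ u∈τ))) (*-congˡ (link-∉ z v∉ρ)) ⟩
    sign v τ ⊛ (sign u τ' ⊛ z τ') ⊹ sign u ρ ⊛ (sign v ρ ⊛ z (ρ ∪ ⁅ v ⁆))
      -- Writing `τ` as `ρ ∪ ⁅ u ⁆` and `τ'` as `ρ ∪ ⁅ v ⁆` brings all four signs over the common
      -- set `ρ`, as `sign-swap` expects.
      ≡⟨ ≡.cong₂ (λ α β → sign v α ⊛ (sign u β ⊛ z β) ⊹ sign u ρ ⊛ (sign v ρ ⊛ z (ρ ∪ ⁅ v ⁆)))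
           (≡.sym (p-x∪⁅x⁆≡p u∈τ)) (p∪⁅x⁆-y≡p-y∪⁅x⁆ τ v≢u) ⟩
    sign v (ρ ∪ ⁅ u ⁆) ⊛ (sign u (ρ ∪ ⁅ v ⁆) ⊛ x) ⊹ sign u ρ ⊛ (sign v ρ ⊛ x)
      ≈⟨ +-cong (*-assoc _ _ _) (*-assoc _ _ _) ⟨
    sign v (ρ ∪ ⁅ u ⁆) ⊛ sign u (ρ ∪ ⁅ v ⁆) ⊛ x ⊹ sign u ρ ⊛ sign v ρ ⊛ x
      ≈⟨ distribʳ _ _ _ ⟨
    (sign v (ρ ∪ ⁅ u ⁆) ⊛ sign u (ρ ∪ ⁅ v ⁆) ⊹ sign u ρ ⊛ sign v ρ) ⊛ x
      ≈⟨ *-congʳ (+-congʳ (sign-swap (v≢u ∘ ≡.sym) (x∉p-x {p = τ}) v∉ρ)) ⟩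
    (⊝ (sign u ρ ⊛ sign v ρ) ⊹ sign u ρ ⊛ sign v ρ) ⊛ x
      ≈⟨ *-congʳ (-‿inverseˡ _) ⟩
    0# ⊛ x
      ≈⟨ zeroˡ x ⟩
    0# ∎
    where
    ρ = τ - u
    τ' = (τ ∪ ⁅ v ⁆) - u
    x = z (ρ ∪ ⁅ v ⁆)
    v∉ρ : v ∉ ρ
    v∉ρ = v∉τ ∘ x∈p-y⇒x∈p

  -- Coning is a contracting homotopy of the augmented full simplex. If `u ∉ τ`, the summands with
  -- `v ≢ u` vanish because `τ ∪ ⁅ v ⁆` avoids `u`; if `u ∈ τ`, they cancel in pairs by
  -- `link-cone-anticomm`. The summand at `u` returns `z τ`.
  cone-homotopy : ∀ (u : Fin n) z τ → ∂ (cone u z) τ ⊹ cone u (∂ z) τ ≈ z τ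
  cone-homotopy u z τ with u ∈? τ
  ... | no u∉τ = begin
    ∂ (cone u z) τ ⊹ 0#   ≈⟨ +-identityʳ _ ⟩
    ∂ (cone u z) τ        ≈⟨ sum-single (λ v → link v (cone u z) τ) u others ⟩
    link u (cone u z) τ   ≈⟨ link-cone z u∉τ ⟩
    z τ                   ∎
    where
    others : ∀ v → v ≢ u → link v (cone u z) τ ≈ 0#
    others v v≢u with v ∈? τ
    ... | yes _ = refl
    ... | no  _ = trans (*-congˡ (cone-∉ z λ u∈ → [ u∉τ , v≢u ∘ ≡.sym ]′ (x∈p∪⁅y⁆⁻ u∈))) (zeroʳ _)
  ... | yes u∈τ = begin
    ∂ (cone u z) τ ⊹ s ⊛ ∂ z ρ
      ≈⟨ +-congˡ (S.*-distribˡ-sum s (λ v → link v z ρ)) ⟩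
    sum (λ v → link v (cone u z) τ) ⊹ sum (λ v → s ⊛ link v z ρ)
      ≈⟨ S.∑-distrib-+ (λ v → link v (cone u z) τ) (λ v → s ⊛ link v z ρ) ⟨
    sum (λ v → link v (cone u z) τ ⊹ s ⊛ link v z ρ)
      ≈⟨ sum-single (λ v → link v (cone u z) τ ⊹ s ⊛ link v z ρ) u
           (λ v v≢u → link-cone-anticomm z v≢u u∈τ) ⟩
    link u (cone u z) τ ⊹ s ⊛ link u z ρ
      ≈⟨ +-cong (link-∈ (cone u z) u∈τ) (sym (cone-∈ (link u z) u∈τ)) ⟩
    0# ⊹ cone u (link u z) τ
      ≈⟨ +-identityˡ _ ⟩
    cone u (link u z) τ
      ≈⟨ cone-link z u∈τ ⟩
    z τ ∎
    where
    ρ = τ - u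
    s = sign u ρ

  ∂-cone : ∀ (u : Fin n) {z} → (∀ τ → ∂ z τ ≈ 0#) → ∀ τ → ∂ (cone u z) τ ≈ z τ
  ∂-cone u {z} ∂z≈0 τ = begin
    ∂ (cone u z) τ                    ≈⟨ +-identityʳ _ ⟨
    ∂ (cone u z) τ ⊹ 0#               ≈⟨ +-congˡ (cone-0 u ∂z≈0 τ) ⟨
    ∂ (cone u z) τ ⊹ cone u (∂ z) τ   ≈⟨ cone-homotopy u z τ ⟩
    z τ                               ∎

  deletion+cone-link : ∀ (u : Fin n) z σ → deletion u z σ ⊹ cone u (link u z) σ ≈ z σ
  deletion+cone-link u z σ = helper (u ∈? σ)
    where
    helper : Dec (u ∈ σ) → deletion u z σ ⊹ cone u (link u z) σ ≈ z σ
    helper (yes u∈σ) = trans (+-cong (deletion-∈ z u∈σ) (cone-link z u∈σ)) (+-identityˡ _)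
    helper (no  u∉σ) = trans (+-cong (deletion-∉ z u∉σ) (cone-∉ (link u z) u∉σ)) (+-identityʳ _)

  module _ (u : Fin n) (z : Subset n → Carrier) (∂z≈0 : ∀ τ → ∂ z τ ≈ 0#) where

    private
      b = link u z

      ∂D+∂Cb≈0 : ∀ τ → ∂ (deletion u z) τ ⊹ ∂ (cone u b) τ ≈ 0#
      ∂D+∂Cb≈0 τ = begin
        ∂ (deletion u z) τ ⊹ ∂ (cone u b) τ          ≈⟨ ∂-+ (deletion u z) (cone u b) τ ⟨
        ∂ (λ σ → deletion u z σ ⊹ cone u b σ) τ      ≈⟨ ∂-cong (deletion+cone-link u z) τ ⟩
        ∂ z τ                                        ≈⟨ ∂z≈0 τ ⟩
        0#                                           ∎

      -- The deletion is supported off `u`, so its boundary vanishes at every set containing `u`.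
      -- Hence so does ∂ of the cone over `b`, and the homotopy leaves only `b τ`, which is zero
      -- there.
      C∂b≈0 : ∀ {τ} → u ∈ τ → cone u (∂ b) τ ≈ 0#
      C∂b≈0 {τ} u∈τ = begin
        cone u (∂ b) τ                        ≈⟨ +-identityˡ _ ⟨
        0# ⊹ cone u (∂ b) τ                   ≈⟨ +-congʳ ∂Cb≈0 ⟨
        ∂ (cone u b) τ ⊹ cone u (∂ b) τ       ≈⟨ cone-homotopy u b τ ⟩
        b τ                                   ≈⟨ link-∈ z u∈τ ⟩
        0#                                    ∎
        where
        ∂Cb≈0 : ∂ (cone u b) τ ≈ 0#
        ∂Cb≈0 = begin
          ∂ (cone u b) τ                        ≈⟨ +-identityˡ _ ⟨
          0# ⊹ ∂ (cone u b) τ                   ≈⟨ +-congʳ (∂-0 (deletion u z) τ λ v → deletion-∈ z (p⊆p∪q ⁅ v ⁆ u∈τ)) ⟨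
          ∂ (deletion u z) τ ⊹ ∂ (cone u b) τ   ≈⟨ ∂D+∂Cb≈0 τ ⟩
          0#                                    ∎

    -- At sets containing `u` every term vanishes. At a set `τ` without `u`, the value is recovered
    -- from `cone u (∂ b)` at `τ ∪ ⁅ u ⁆`, which `C∂b≈0` shows to be zero.
    ∂-link : ∀ τ → ∂ (link u z) τ ≈ 0#
    ∂-link τ = helper (u ∈? τ)
      where
      helper : Dec (u ∈ τ) → ∂ b τ ≈ 0#
      helper (yes u∈τ) = ∂-0 b τ λ v → link-∈ z (p⊆p∪q ⁅ v ⁆ u∈τ)
      helper (no  u∉τ) = begin
        ∂ b τ                                   ≈⟨ link-cone (∂ b) u∉τ ⟨
        link u (cone u (∂ b)) τ                 ≈⟨ link-∉ (cone u (∂ b)) u∉τ ⟩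
        sign u τ ⊛ cone u (∂ b) (τ ∪ ⁅ u ⁆)     ≈⟨ *-congˡ (C∂b≈0 (x∈p∪⁅x⁆ {p = τ})) ⟩
        sign u τ ⊛ 0#                           ≈⟨ zeroʳ _ ⟩
        0#                                      ∎

    -- As `b` is a cycle, it is the boundary of its own cone, and the deletion and that cone add up
    -- to the cycle `z`.
    ∂-deletion+link : ∀ τ → ∂ (deletion u z) τ ⊹ link u z τ ≈ 0#
    ∂-deletion+link τ = begin
      ∂ (deletion u z) τ ⊹ b τ              ≈⟨ +-congˡ (∂-cone u ∂-link τ) ⟨
      ∂ (deletion u z) τ ⊹ ∂ (cone u b) τ   ≈⟨ ∂D+∂Cb≈0 τ ⟩
      0#                                    ∎

-- Closed neighbourhoods and extensions of independent sets

module ClosedNeighbourhoods (G : SimpleGraph n) where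
  open SimpleGraph G

  ∈-neighbours⁺ : ∀ {u v} → Adj u v → v ∈ neighbours G u
  ∈-neighbours⁺ {u} = ∈-tabulate⁺ (adj? u)

  ∈-neighbours⁻ : ∀ {u v} → v ∈ neighbours G u → Adj u v
  ∈-neighbours⁻ {u} = ∈-tabulate⁻ (adj? u)

  infixl 5 _─N[_]
  -- For `v ∈ S`, the independence complex on this set is the link of `v` in the independence
  -- complex on `S`.
  _─N[_] : Subset n → Fin n → Subset n
  S ─N[ v ] = (S ─ neighbours G v) - v

  module _ {S : Subset n} {v : Fin n} where

    ─N[]-⊆ : S ─N[ v ] ⊆ S
    ─N[]-⊆ = p─q⊆p S (neighbours G v) ∘ x∈p-y⇒x∈p

    ∈─N[]⇒≢ : ∀ {x} → x ∈ S ─N[ v ] → x ≢ v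
    ∈─N[]⇒≢ = x∈p-y⇒x≢y {p = S ─ neighbours G v}

    ∈─N[]⇒¬Adj : ∀ {x} → x ∈ S ─N[ v ] → ¬ Adj v x
    ∈─N[]⇒¬Adj x∈ v~x =
      x∈p─q⇒x∉q S (neighbours G v) (x∈p-y⇒x∈p x∈) (∈-neighbours⁺ v~x)

    ∈─N[]⁺ : ∀ {x} → x ∈ S → x ≢ v → ¬ Adj v x → x ∈ S ─N[ v ]
    ∈─N[]⁺ x∈S x≢v v≁x =
      x∈p∧x≢y⇒x∈p-y (x∈p∧x∉q⇒x∈p─q x∈S (v≁x ∘ ∈-neighbours⁻)) x≢v

  independent-∪ : ∀ {σ v} → Independent G σ → (∀ {x} → x ∈ σ → ¬ Adj v x) →
                  Independent G (σ ∪ ⁅ v ⁆)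
  independent-∪ ind v≁ x∈ y∈ with x∈p∪⁅y⁆⁻ x∈ | x∈p∪⁅y⁆⁻ y∈
  ... | inj₁ x∈σ    | inj₁ y∈σ    = ind x∈σ y∈σ
  ... | inj₁ x∈σ    | inj₂ ≡.refl = v≁ x∈σ ∘ sym
  ... | inj₂ ≡.refl | inj₁ y∈σ    = v≁ y∈σ
  ... | inj₂ ≡.refl | inj₂ ≡.refl = irrefl ≡.refl

  ⊆-∪⁅⁆ : ∀ {σ S : Subset n} {v} → σ ⊆ S → v ∈ S → σ ∪ ⁅ v ⁆ ⊆ S
  ⊆-∪⁅⁆ σ⊆S v∈S x∈ with x∈p∪⁅y⁆⁻ x∈
  ... | inj₁ x∈σ    = σ⊆S x∈σ
  ... | inj₂ ≡.refl = v∈S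

-- Homology of independence complexes

module IndependenceHomology (𝕜 : HeytingField c ℓ₁ ℓ₂) (G : SimpleGraph n) where
  open SimplexChains 𝕜
  open ClosedNeighbourhoods G
  open SimpleGraph G using (Adj; irrefl) renaming (sym to Adj-sym)

  Face : Subset n → Subset n → Set
  Face S = SimplicialComplex.Face (Ind G S)

  -- A negative notion: it refutes nonzero classes without producing fillings, as being a boundary
  -- need not be decidable over a Heyting field.
  Acyclic : Subset n → ℕ → Set _
  Acyclic S j = ¬ HomologyNonzero (Ind G S) j

  module _ {S : Subset n} {j : ℕ} where

    no-faces⇒acyclic : (∀ σ → Face S σ → ∣ σ ∣ ≢ j) → Acyclic S j
    no-faces⇒acyclic ¬face (z , _ , z∉B) = z∉B (0-chain , λ σ →
      trans (∂-0 (λ _ → 0#) σ (λ _ → refl))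
            (sym (support z σ λ (face , ∣σ∣≡j) → ¬face σ face ∣σ∣≡j)))
      where
      0-chain : Chain (Ind G S) (suc j)
      0-chain = record { coeff = λ _ → 0# ; support = λ _ _ → refl }

    -- The cone reads `z` only at sets `σ - v`, so the hypothesis concerns sets avoiding `v`. Asking
    -- for `σ ∪ ⁅ v ⁆` to be a face covers both chains on extendable faces and chains on the link of
    -- `v`.
    cone-support : ∀ {v} (z : Subset n → Carrier) →
      (∀ σ → v ∉ σ → ¬ (Face S (σ ∪ ⁅ v ⁆) × ∣ σ ∣ ≡ j) → z σ ≈ 0#) →
      ∀ σ → ¬ (Face S σ × ∣ σ ∣ ≡ suc j) → cone v z σ ≈ 0#
    cone-support {v} z z-support σ ¬face with v ∈? σ
    ... | no  _   = refl
    ... | yes v∈σ = trans (*-congˡ (z-support (σ - v) (x∉p-x {p = σ}) λ (face , ∣σ-v∣≡j) →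
      ¬face ( subst (Face S) (p-x∪⁅x⁆≡p v∈σ) face
            , ≡.trans (≡.trans (cong ∣_∣ (≡.sym (p-x∪⁅x⁆≡p v∈σ)))
                               (∣p∪⁅x⁆∣≡1+∣p∣ (σ - v) (x∉p-x {p = σ})))
                      (cong suc ∣σ-v∣≡j))))
      (zeroʳ _)

    -- Every cycle bounds its cone with apex `v`. Only faces with `j` vertices have to extend, so
    -- this also applies to the empty face alone when `j` is 0.
    cone⇒acyclic : ∀ v → (∀ σ → Face S σ → ∣ σ ∣ ≡ j → Face S (σ ∪ ⁅ v ⁆)) → Acyclic S j
    cone⇒acyclic v extend (z , ∂z≈0 , z∉B) = z∉B (vz , ∂-cone v ∂z≈0)
      where
      vz : Chain (Ind G S) (suc j)
      vz = record
        { coeff   = cone v (coeff z)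
        ; support = cone-support (coeff z) λ σ v∉σ ¬face →
            support z σ λ (face , ∣σ∣≡j) → ¬face (extend σ face ∣σ∣≡j , ∣σ∣≡j)
        }

  isolated⇒acyclic : ∀ {S j v} → v ∈ S → (∀ {x} → x ∈ S → ¬ Adj v x) → Acyclic S j
  isolated⇒acyclic {v = v} v∈S v≁ = cone⇒acyclic v λ σ (σ⊆S , ind) _ →
    ⊆-∪⁅⁆ σ⊆S v∈S , independent-∪ ind (v≁ ∘ σ⊆S)

  -- The empty set is then the only face, so every chain of higher degree is zero.
  empty⇒j≡0 : ∀ {S j} → Empty S → HomologyNonzero (Ind G S) j → j ≡ 0
  empty⇒j≡0 {j = zero}  _     _  = ≡.refl
  empty⇒j≡0 {j = suc j} empty nz = contradiction nz (no-faces⇒acyclic λ σ (σ⊆S , _) ∣σ∣≡1+j →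
    ℕ.0≢1+n (≡.trans (≡.sym (∣σ∣≡0 σ σ⊆S)) ∣σ∣≡1+j))
    where
    ∣σ∣≡0 : ∀ σ → σ ⊆ _ → ∣ σ ∣ ≡ 0
    ∣σ∣≡0 σ σ⊆S = ≡.trans (cong ∣_∣ (Empty-unique λ (x , x∈σ) → empty (x , σ⊆S x∈σ))) (∣⊥∣≡0 n)

  nonempty⇒acyclic-0 : ∀ {S v} → v ∈ S → Acyclic S 0
  nonempty⇒acyclic-0 {v = v} v∈S = cone⇒acyclic v λ σ (σ⊆S , ind) ∣σ∣≡0 →
    ⊆-∪⁅⁆ σ⊆S v∈S , independent-∪ ind λ x∈σ _ →
      ℕ.n≮0 (ℕ.<-≤-trans (x∈p⇒∣p-x∣<∣p∣ x∈σ) (ℕ.≤-reflexive ∣σ∣≡0))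

  -- Write a cycle z as D + v·b with D avoiding v.  If b = ∂c in the link of v,
  -- then z is homologous to the cycle D + c, which avoids v.

  deletion-link : ∀ {S v j} → v ∈ S → Acyclic (S - v) (suc j) → Acyclic (S ─N[ v ]) j →
                  Acyclic S (suc j)
  deletion-link {S} {v} {j} v∈S del-acyclic link-acyclic (z , ∂z≈0 , z∉B) =
    link-acyclic (linkChain , ∂-link v (coeff z) ∂z≈0 , λ (y , ∂y≈b) →
      del-acyclic (delChain y , delChain-cycle y ∂y≈b , λ (x , ∂x≈D+y) →
        z∉B (filling y x , filling-∂ y ∂y≈b x ∂x≈D+y)))
    where
    D b : Subset n → Carrier
    D = deletion v (coeff z)
    b = link v (coeff z)

    link-face : ∀ {σ} → v ∉ σ → Face S (σ ∪ ⁅ v ⁆) → Face (S ─N[ v ]) σ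
    link-face {σ} v∉σ (σv⊆S , ind) =
      (λ {x} x∈σ → ∈─N[]⁺ (σv⊆S (p⊆p∪q ⁅ v ⁆ x∈σ)) (λ { ≡.refl → v∉σ x∈σ })
                     (ind (x∈p∪⁅x⁆ {p = σ}) (p⊆p∪q ⁅ v ⁆ x∈σ))) ,
      λ x∈σ y∈σ → ind (p⊆p∪q ⁅ v ⁆ x∈σ) (p⊆p∪q ⁅ v ⁆ y∈σ)

    linkChain : Chain (Ind G (S ─N[ v ])) j
    linkChain = record { coeff = b ; support = b-support }
      where
      b-support : ∀ σ → ¬ (Face (S ─N[ v ]) σ × ∣ σ ∣ ≡ j) → b σ ≈ 0#
      b-support σ ¬face with v ∈? σ
      ... | yes _   = refl
      ... | no  v∉σ = trans (*-congˡ (support z (σ ∪ ⁅ v ⁆) λ (face , ∣σv∣≡1+j) →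
        ¬face ( link-face v∉σ face
              , ℕ.suc-injective (≡.trans (≡.sym (∣p∪⁅x⁆∣≡1+∣p∣ σ v∉σ)) ∣σv∣≡1+j))))
        (zeroʳ _)

    D-support : ∀ σ → ¬ (Face (S - v) σ × ∣ σ ∣ ≡ suc j) → D σ ≈ 0#
    D-support σ ¬face with v ∈? σ
    ... | yes _   = refl
    ... | no  v∉σ = support z σ λ ((σ⊆S , ind) , ∣σ∣≡1+j) →
      ¬face (((λ {x} x∈σ → x∈p∧x≢y⇒x∈p-y (σ⊆S x∈σ) λ { ≡.refl → v∉σ x∈σ }) , ind) , ∣σ∣≡1+j)

    module _ (y : Chain (Ind G (S ─N[ v ])) (suc j)) where

      delChain : Chain (Ind G (S - v)) (suc j)
      delChain = record
        { coeff   = λ σ → D σ ⊹ coeff y σ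
        ; support = λ σ ¬face → trans (+-cong (D-support σ ¬face) (support y σ
            λ ((σ⊆ , ind) , ∣σ∣≡1+j) → ¬face
              (((λ x∈σ → x∈p∧x≢y⇒x∈p-y (─N[]-⊆ (σ⊆ x∈σ)) (∈─N[]⇒≢ {S = S} (σ⊆ x∈σ))) , ind) , ∣σ∣≡1+j)))
            (+-identityˡ 0#)
        }

      module _ (∂y≈b : ∀ σ → ∂ (coeff y) σ ≈ b σ) where

        delChain-cycle : IsCycle (Ind G (S - v)) delChain
        delChain-cycle τ = begin
          ∂ (coeff delChain) τ        ≈⟨ ∂-+ D (coeff y) τ ⟩
          ∂ D τ ⊹ ∂ (coeff y) τ       ≈⟨ +-congˡ (∂y≈b τ) ⟩
          ∂ D τ ⊹ b τ                 ≈⟨ ∂-deletion+link v (coeff z) ∂z≈0 τ ⟩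
          0#                          ∎

      vy : Subset n → Carrier
      vy = cone v (coeff y)

      vy-support : ∀ σ → ¬ (Face S σ × ∣ σ ∣ ≡ suc (suc j)) → vy σ ≈ 0#
      vy-support = cone-support (coeff y) λ σ v∉σ ¬face →
        support y σ λ ((σ⊆ , ind) , ∣σ∣≡1+j) → ¬face
          ( ( ⊆-∪⁅⁆ (─N[]-⊆ ∘ σ⊆) v∈S
            , independent-∪ ind (∈─N[]⇒¬Adj {S = S} ∘ σ⊆))
          , ∣σ∣≡1+j)

      -- Here `y` is the chain called c above. By the cone homotopy ∂(v·y) = y - v·b, so subtracting
      -- v·y from `x` turns the boundary D + y into D + v·b, which is `z`.
      filling : Chain (Ind G (S - v)) (suc (suc j)) → Chain (Ind G S) (suc (suc j))
      filling x = record
        { coeff   = λ σ → coeff x σ ⊹ ⊝ vy σ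
        ; support = λ σ ¬face → trans
            (+-cong (support x σ λ ((σ⊆ , ind) , ∣σ∣≡2+j) → ¬face ((x∈p-y⇒x∈p ∘ σ⊆ , ind) , ∣σ∣≡2+j))
                    (-‿cong (vy-support σ ¬face)))
            (-‿inverseʳ 0#)
        }

      filling-∂ : (∀ σ → ∂ (coeff y) σ ≈ b σ) →
                  ∀ x → (∀ σ → ∂ (coeff x) σ ≈ D σ ⊹ coeff y σ) →
                  ∀ σ → ∂ (coeff (filling x)) σ ≈ coeff z σ
      filling-∂ ∂y≈b x ∂x≈D+y σ = begin
        ∂ (coeff (filling x)) σ                         ≈⟨ ∂-+ (coeff x) (λ τ → ⊝ vy τ) σ ⟩
        ∂ (coeff x) σ ⊹ ∂ (λ τ → ⊝ vy τ) σ              ≈⟨ +-cong (∂x≈D+y σ) (∂-⊝ vy σ) ⟩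
        (D σ ⊹ coeff y σ) ⊹ ⊝ ∂ vy σ                    ≈⟨ +-congʳ (+-congˡ (cone-homotopy v (coeff y) σ)) ⟨
        (D σ ⊹ (∂ vy σ ⊹ cone v (∂ (coeff y)) σ)) ⊹ ⊝ ∂ vy σ
          ≈⟨ +-congʳ (+-congˡ (+-congˡ (cone-cong v ∂y≈b σ))) ⟩
        (D σ ⊹ (∂ vy σ ⊹ cone v b σ)) ⊹ ⊝ ∂ vy σ        ≈⟨ +-congʳ (x∙yz≈y∙xz _ _ _) ⟩
        (∂ vy σ ⊹ (D σ ⊹ cone v b σ)) ⊹ ⊝ ∂ vy σ        ≈⟨ xyx⁻¹≈y _ _ ⟩
        D σ ⊹ cone v b σ                                ≈⟨ deletion+cone-link v (coeff z) σ ⟩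
        coeff z σ                                       ∎

  -- The contrapositive of `deletion-link`; it does not decide which alternative occurs, hence the
  -- double negation. Degree 0 is excluded because the vertex `v` fills the empty face.
  splitting : ∀ {S v j} → v ∈ S → HomologyNonzero (Ind G S) j →
              ¬ ¬ (HomologyNonzero (Ind G (S - v)) j ⊎
                   (Σ[ i ∈ ℕ ] j ≡ suc i × HomologyNonzero (Ind G (S ─N[ v ])) i))
  splitting {j = zero}  v∈S nz k = nonempty⇒acyclic-0 v∈S nz
  splitting {j = suc j} v∈S nz k = deletion-link v∈S
    (λ nz′ → k (inj₁ nz′)) (λ nz′ → k (inj₂ (j , ≡.refl , nz′))) nz

  -- Detaching an edge by repeated splitting

  Detached : Fin n → Fin n → Subset n → Set
  Detached u v T = ∀ {x} → x ∈ T → (x ≢ u × x ≢ v) × ¬ Adj u x × ¬ Adj v x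

  private
    shrink : ∀ {P T T′ : Subset n} {k v} → ∣ P ∩ T ∣ ≤ suc k → v ∈ P ∩ T →
             T′ ⊆ T → v ∉ T′ → ∣ P ∩ T′ ∣ ≤ k
    shrink {P} {T} {T′} {v = v} ∣P∩T∣≤1+k v∈P∩T T′⊆T v∉T′ =
      ℕ.≤-pred (ℕ.<-≤-trans (p⊂q⇒∣p∣<∣q∣ (P∩T′⊆P∩T , v , v∈P∩T , v∉T′ ∘ proj₂ ∘ x∈p∩q⁻ P T′)) ∣P∩T∣≤1+k)
      where
      P∩T′⊆P∩T : P ∩ T′ ⊆ P ∩ T
      P∩T′⊆P∩T x∈ with x∈p∩q⁻ P T′ x∈
      ... | x∈P , x∈T′ = x∈p∩q⁺ (x∈P , T′⊆T x∈T′)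

    nonempty⇒≰0 : ∀ {p : Subset n} → Nonempty p → ¬ ∣ p ∣ ≤ 0
    nonempty⇒≰0 (x , x∈p) ∣p∣≤0 = ℕ.n≮0 (ℕ.<-≤-trans (x∈p⇒∣p-x∣<∣p∣ x∈p) ∣p∣≤0)

  -- Each splitting at a vertex of `P` removes that vertex and costs at most one homological degree,
  -- so `k` bounds both the number of rounds and the total loss.
  clear : ∀ P {T j} k → ∣ P ∩ T ∣ ≤ k → HomologyNonzero (Ind G T) j →
          ¬ ¬ (∃₂ λ T′ i → T′ ⊆ T × Empty (P ∩ T′) × j ≤ k + i × HomologyNonzero (Ind G T′) i)
  clear P {T} {j} k ∣P∩T∣≤k nz ret with nonempty? (P ∩ T)
  ... | no empty = ret (T , j , ⊆-refl , empty , ℕ.m≤n+m j k , nz)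
  clear P zero ∣P∩T∣≤0 nz ret | yes nonempty = nonempty⇒≰0 nonempty ∣P∩T∣≤0
  clear P {T} {j} (suc k) ∣P∩T∣≤1+k nz ret | yes (v , v∈P∩T) =
    splitting (proj₂ (x∈p∩q⁻ P T v∈P∩T)) nz λ where
      (inj₁ nz′) →
        clear P k (shrink ∣P∩T∣≤1+k v∈P∩T x∈p-y⇒x∈p (x∉p-x {p = T})) nz′
          λ (T′ , i , T′⊆ , empty , j≤k+i , nz″) →
            ret (T′ , i , x∈p-y⇒x∈p ∘ T′⊆ , empty , ℕ.m≤n⇒m≤1+n j≤k+i , nz″)
      (inj₂ (j′ , ≡.refl , nz′)) →
        clear P k (shrink ∣P∩T∣≤1+k v∈P∩T ─N[]-⊆ (λ v∈ → ∈─N[]⇒≢ {S = T} v∈ ≡.refl)) nz′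
          λ (T′ , i , T′⊆ , empty , j≤k+i , nz″) →
            ret (T′ , i , ─N[]-⊆ ∘ T′⊆ , empty , s≤s j≤k+i , nz″)

  -- Split at neighbours of `u` until a link branch first occurs; that neighbour is `v`. The link
  -- branch costs one degree, and the neighbours of `u` that survive it are then removed by `clear`,
  -- within the same budget `k`.
  detach : ∀ {u T j} k → u ∈ T → ∣ neighbours G u ∩ T ∣ ≤ k → HomologyNonzero (Ind G T) j →
           ¬ ¬ (∃ λ v → ∃₂ λ T′ i → Adj u v × v ∈ T × T′ ⊆ T × Detached u v T′ ×
                                    j ≤ k + i × HomologyNonzero (Ind G T′) i)
  detach {u} {T} k u∈T ∣N∩T∣≤k nz ret with nonempty? (neighbours G u ∩ T)
  -- If only deletions occurred, `u` ends up isolated and the homology would vanish, so a link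
  -- branch must have been taken.
  ... | no empty = isolated⇒acyclic u∈T
    (λ x∈T u~x → empty (_ , x∈p∩q⁺ (∈-neighbours⁺ u~x , x∈T))) nz
  detach zero u∈T ∣N∩T∣≤0 nz ret | yes nonempty = nonempty⇒≰0 nonempty ∣N∩T∣≤0
  detach {u} {T} (suc k) u∈T ∣N∩T∣≤1+k nz ret | yes (v , v∈N∩T) =
    splitting v∈T nz λ where
      (inj₁ nz′) →
        detach k (x∈p∧x≢y⇒x∈p-y u∈T u≢v)
               (shrink ∣N∩T∣≤1+k v∈N∩T x∈p-y⇒x∈p (x∉p-x {p = T})) nz′
          λ (w , T′ , i , u~w , w∈ , T′⊆ , detached , j≤k+i , nz″) →
            ret (w , T′ , i , u~w , x∈p-y⇒x∈p w∈ , x∈p-y⇒x∈p ∘ T′⊆ , detached , ℕ.m≤n⇒m≤1+n j≤k+i , nz″)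
      (inj₂ (j′ , ≡.refl , nz′)) →
        clear (neighbours G u) k
              (shrink ∣N∩T∣≤1+k v∈N∩T ─N[]-⊆ (λ v∈ → ∈─N[]⇒≢ {S = T} v∈ ≡.refl)) nz′
          λ (T′ , i , T′⊆ , empty , j≤k+i , nz″) →
            ret (v , T′ , i , u~v , v∈T , ─N[]-⊆ ∘ T′⊆
                , (λ x∈T′ → let x∈ = T′⊆ x∈T′ in
                    -- As a neighbour of `v`, the vertex `u` left together with the closed
                    -- neighbourhood of `v`.
                    ( (λ { ≡.refl → ∈─N[]⇒¬Adj {S = T} x∈ (Adj-sym u~v) }) , ∈─N[]⇒≢ {S = T} x∈)
                    , (λ u~x → empty (_ , x∈p∩q⁺ (∈-neighbours⁺ u~x , x∈T′)))
                    , ∈─N[]⇒¬Adj {S = T} x∈)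
                , s≤s j≤k+i , nz″)
    where
    v∈T : v ∈ T
    v∈T = proj₂ (x∈p∩q⁻ (neighbours G u) T v∈N∩T)
    u~v : Adj u v
    u~v = ∈-neighbours⁻ (proj₁ (x∈p∩q⁻ (neighbours G u) T v∈N∩T))
    u≢v : u ≢ v
    u≢v u≡v = irrefl u≡v u~v

-- Degenerate graphs

module _ (G : SimpleGraph n) where
  open SimpleGraph G

  -- This is `d`-degeneracy of the graph induced on `S`: the cardinality is the degree of `u` in the
  -- graph induced on `T`.
  Degenerate : ℕ → Subset n → Set
  Degenerate d S = ∀ T → T ⊆ S → Nonempty T → ∃[ u ] u ∈ T × ∣ neighbours G u ∩ T ∣ ≤ d

  MatchingWithin : Subset n → ℕ → Set
  MatchingWithin S m = Σ[ M ∈ InducedMatching G m ] (∀ i {x} → InducedMatching.EndOf M i x → x ∈ S)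

-- Induced matchings from nonzero homology

module _ (𝕜 : HeytingField c ℓ₁ ℓ₂) (G : SimpleGraph n) where
  open SimpleGraph G
  open Homology 𝕜
  open IndependenceHomology 𝕜 G

  empty-matching : ∀ {S} → MatchingWithin G S 0
  empty-matching =
    record { source = λ () ; target = λ () ; isEdge = λ () ; separated = λ { {()} } } , λ ()

  -- The clauses of `Detached` are exactly what `separated` demands between the new edge and edges
  -- with ends in `T`.
  extend-matching : ∀ {S T u v m} → u ∈ S → v ∈ S → Adj u v → T ⊆ S → Detached u v T →
                    MatchingWithin G T m → MatchingWithin G S (suc m)
  extend-matching {S} {T} {u} {v} {m} u∈S v∈S u~v T⊆S detached (M , ends∈T) = M′ , ends∈S
    where
    module M = InducedMatching M

    away : ∀ {x y} → x ≡ u ⊎ x ≡ v → y ∈ T → x ≢ y × ¬ Adj x y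
    away (inj₁ ≡.refl) y∈T = proj₁ (proj₁ (detached y∈T)) ∘ ≡.sym , proj₁ (proj₂ (detached y∈T))
    away (inj₂ ≡.refl) y∈T = proj₂ (proj₁ (detached y∈T)) ∘ ≡.sym , proj₂ (proj₂ (detached y∈T))

    source target : Fin (suc m) → Fin n
    source zero    = u
    source (suc i) = M.source i
    target zero    = v
    target (suc i) = M.target i

    isEdge : ∀ i → Adj (source i) (target i)
    isEdge zero    = u~v
    isEdge (suc i) = M.isEdge i

    separated : ∀ {i j} → i ≢ j → ∀ {x y} → x ≡ source i ⊎ x ≡ target i →
                y ≡ source j ⊎ y ≡ target j → x ≢ y × ¬ Adj x y
    separated {zero}  {zero}  i≢j _ _ = contradiction ≡.refl i≢j
    separated {zero}  {suc j} _ x∈i y∈j = away x∈i (ends∈T j y∈j)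
    separated {suc i} {zero}  _ x∈i y∈j with away y∈j (ends∈T i x∈i)
    ... | y≢x , y≁x = y≢x ∘ ≡.sym , y≁x ∘ sym
    separated {suc i} {suc j} i≢j x∈i y∈j = M.separated (i≢j ∘ cong suc) x∈i y∈j

    M′ : InducedMatching G (suc m)
    M′ = record { source = source ; target = target ; isEdge = isEdge ; separated = separated }

    ends∈S : ∀ i {x} → InducedMatching.EndOf M′ i x → x ∈ S
    ends∈S zero    (inj₁ ≡.refl) = u∈S
    ends∈S zero    (inj₂ ≡.refl) = v∈S
    ends∈S (suc i) x∈i = T⊆S (ends∈T i x∈i)

  degenerate-matching : ∀ d {S j} → Acc _⊂_ S → Degenerate G d S → HomologyNonzero (Ind G S) j →
                        ¬ ¬ (∃[ m ] j ≤ d * m × MatchingWithin G S m)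
  degenerate-matching d {S} {j} (acc rs) degenerate nz ret with nonempty? S
  ... | no empty = ret (0 , ℕ.≤-trans (ℕ.≤-reflexive (empty⇒j≡0 empty nz)) z≤n , empty-matching)
  ... | yes nonempty with degenerate S ⊆-refl nonempty
  ...   | u , u∈S , ∣N∩S∣≤d = detach d u∈S ∣N∩S∣≤d nz
    λ (v , T , i , u~v , v∈S , T⊆S , detached , j≤d+i , nzT) →
      degenerate-matching d
        -- Detachment removes `u` itself, so the recursion descends to a proper subset.
        (rs (T⊆S , u , u∈S , λ u∈T → proj₁ (proj₁ (detached u∈T)) ≡.refl))
        (λ T′ T′⊆T → degenerate T′ (T⊆S ∘ T′⊆T)) nzT
        λ (m , i≤dm , matching) → ret
          ( suc m
          , ℕ.≤-trans j≤d+i (ℕ.≤-trans (ℕ.+-monoʳ-≤ d i≤dm) (ℕ.≤-reflexive (≡.sym (ℕ.*-suc d m))))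
          , extend-matching u∈S v∈S u~v T⊆S detached matching)

  degenerate-bound : ∀ {d im S j} → IsInducedMatchingNumber G im → Degenerate G d S →
                     HomologyNonzero (Ind G S) j → j ≤ d * im
  degenerate-bound {d} (_ , maximal) degenerate nz = decidable-stable (_ ℕ.≤? _) λ j≰ →
    degenerate-matching d (⊂-wellFounded _) degenerate nz λ (m , j≤dm , M , _) →
      j≰ (ℕ.≤-trans j≤dm (ℕ.*-monoʳ-≤ d (maximal m M)))

-- Degeneracy of connected graphs

module _ (G : SimpleGraph n) (connected : Connected G) where
  open SimpleGraph G
  open ClosedNeighbourhoods G

  adj-closed⇒∈ : ∀ {T} → (∀ {u v} → u ∈ T → Adj u v → v ∈ T) →
                 ∀ {u v} → u ∈ T → Star Adj u v → v ∈ T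
  adj-closed⇒∈ closed u∈T ε          = u∈T
  adj-closed⇒∈ closed u∈T (u~w ◅ w⋆v) = adj-closed⇒∈ closed (closed u∈T u~w) w⋆v

  -- If every vertex of `T` had more than `d` neighbours in `T`, the bound `suc d` would force all
  -- its neighbours into `T`. Connectedness then puts `x` in `T`, hence in `S`, where its degree is
  -- at most `d`. Since `low` is conditional, a vertex `x` outside `S` serves as well.
  degenerate : ∀ {d S} → (∀ v → degree G v ≤ suc d) →
               ∀ x → (x ∈ S → degree G x ≤ d) → Degenerate G d S
  degenerate {d} degree≤ x low T T⊆S (t , t∈T)
    with Fin.any? (λ u → (u ∈? T) ×-dec (∣ neighbours G u ∩ T ∣ ℕ.≤? d))
  ... | yes found = found
  ... | no  none  = contradiction
    (x , x∈T , ℕ.≤-trans (∣p∩q∣≤∣p∣ (neighbours G x) T) (low (T⊆S x∈T))) none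
    where
    closed : ∀ {u v} → u ∈ T → Adj u v → v ∈ T
    closed {u} {v} u∈T u~v with v ∈? T
    ... | yes v∈T = v∈T
    ... | no  v∉T = contradiction (u , u∈T , ℕ.≤-pred (ℕ.<-≤-trans
      (p⊂q⇒∣p∣<∣q∣ ( proj₁ ∘ x∈p∩q⁻ (neighbours G u) T
                   , v , ∈-neighbours⁺ u~v , v∉T ∘ proj₂ ∘ x∈p∩q⁻ (neighbours G u) T))
      (degree≤ u))) none
    x∈T : x ∈ T
    x∈T = adj-closed⇒∈ closed t∈T (proj₂ connected t x)

-- Extremal degrees and the two cases

degree≤Δ : (G : SimpleGraph n) → ∀ v → degree G v ≤ Δ G
degree≤Δ G v = All.lookup (Extrema.xs≤max 0 (degrees G)) (∈-map⁺ (degree G) (∈-allFin v))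

min-degree : (G : SimpleGraph n) → Fin n → ∀ {d} → (∀ v → d ≤ degree G v) → d ≤ δ G
-- The default value `n` of the minimum must also be at least `d`; the vertex `v` gives this, as its
-- degree is at most `n`.
min-degree G v d≤degree = Extrema.v≤min⁺ (ℕ.≤-trans (d≤degree v) (∣p∣≤n (neighbours G v)))
  (All.map⁺ {xs = allFin _} (All.tabulate λ {u} _ → d≤degree u))

mainTheorem11 : ∀ {c ℓ₁ ℓ₂} (𝕜 : HeytingField c ℓ₁ ℓ₂) {n : ℕ} (G : SimpleGraph n) →
    Connected G → Bipartite G →
    ∀ (reg im : ℕ) → IsRegularity 𝕜 G reg → IsInducedMatchingNumber G im →
    (δ G < Δ G → Δ G ≤ 3 → reg ≤ 2 * im) ×
    (Regular G 3 → reg ≤ 2 * im + 1)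
mainTheorem11 𝕜 G connected _ reg im ((S , nz) , _) isIm = irregular , cubic
  where
  open Homology 𝕜
  open IndependenceHomology 𝕜 G
  open ClosedNeighbourhoods G
  x₀ = proj₁ connected

  irregular : δ G < Δ G → Δ G ≤ 3 → reg ≤ 2 * im
  irregular δ<Δ Δ≤3 with Fin.any? (λ v → degree G v ℕ.≤? 2)
  ... | yes (x , low) = degenerate-bound 𝕜 G isIm
    (degenerate G connected (λ v → ℕ.≤-trans (degree≤Δ G v) Δ≤3) x (λ _ → low)) nz
  -- Without a vertex of degree at most 2, the minimum degree is at least 3 and so not below the
  -- maximum.
  ... | no  none = contradiction
    (ℕ.≤-trans Δ≤3 (min-degree G x₀ λ v → ℕ.≰⇒> λ low → none (v , low)))
    (ℕ.<⇒≱ δ<Δ)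

  -- A set missing `x₀` meets the degree condition at `x₀` vacuously, so it is 2-degenerate although
  -- every degree in `G` is 3.
  avoiding-x₀ : Regular G 3 → ∀ {T j} → x₀ ∉ T → HomologyNonzero (Ind G T) j → j ≤ 2 * im
  avoiding-x₀ regular x₀∉T = degenerate-bound 𝕜 G isIm
    (degenerate G connected (ℕ.≤-reflexive ∘ regular) x₀ (λ x₀∈T → contradiction x₀∈T x₀∉T))

  cubic : Regular G 3 → reg ≤ 2 * im + 1
  cubic regular with x₀ ∈? S
  ... | no  x₀∉S = ℕ.m≤n⇒m≤n+o 1 (avoiding-x₀ regular x₀∉S nz)
  -- Both branches of one splitting at `x₀` avoid `x₀`. The link branch lowers the degree by one,
  -- which is the extra 1 in the bound.
  ... | yes x₀∈S = decidable-stable (_ ℕ.≤? _) λ reg≰ → splitting x₀∈S nz λ where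
    (inj₁ nz′) → reg≰ (ℕ.m≤n⇒m≤n+o 1 (avoiding-x₀ regular (x∉p-x {p = S}) nz′))
    (inj₂ (i , ≡.refl , nz′)) → reg≰ (ℕ.≤-trans
      (s≤s (avoiding-x₀ regular (λ x₀∈ → ∈─N[]⇒≢ {S = S} x₀∈ ≡.refl) nz′))
      (ℕ.≤-reflexive (ℕ.+-comm 1 (2 * im))))
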